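{- The systems $\mathsf{MLS}=\{\mathsf{ai}{\downarrow},\mathsf{s},\mathsf{u}_1{\downarrow},\mathsf{u}_1{\uparrow},\mathsf{u}_2{\downarrow},\mathsf{u}_2{\uparrow}\}$ and $\mathsf{MLSu}=\{\mathsf{ai}{\downarrow},\mathsf{s},\mathsf{u}_1{\downarrow},\mathsf{u}_2{\downarrow}\}$ for multiplicative linear logic are equivalent, i.e. a structure has a proof in $\mathsf{MLS}$ if and only if it has a proof in $\mathsf{MLSu}$.
   Context: Structures. There are countably many atoms $a,b,c,\dots$; structures of multiplicative linear logic are generated by $R ::= a \mid \mathsf 1 \mid \bot \mid [R \wp R] \mid (R\otimes R) \mid \overline{R}$, where $\mathsf 1$ and $\bot$ (the units) are regarded as special atoms. $[R\wp T]$ is called a par structure, $(R\otimes T)$ a copar structure, $\overline R$ the negation of $R$. Structures are considered modulo $\approx$, the smallest congruence induced by associativity and commutativity of $\wp$ and of $\otimes$ and by $\overline{[R\wp T]}\approx(\overline R\otimes\overline T)$, $\overline{(R\otimes T)}\approx[\overline R\wp\overline T]$, $\overline{\overline R}\approx R$, $\overline\bot\approx\mathsf 1$, $\overline{\mathsf 1}\approx\bot$; they are taken in negation normal form (negation only on atoms). There are no equations for units in $\approx$. A context $S\{\ \}$ is a structure with one hole not in the scope of a negation; $S\{R\}$ is the result of filling it with $R$; $S[R\wp T]$ and $S(R\otimes T)$ abbreviate $S\{[R\wp T]\}$ and $S\{(R\otimes T)\}$. Rules (for all contexts $S\{\ \}$, structures $R,T,U$, atoms $a$), each with one premise and one conclusion: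 - $\mathsf{ai}{\downarrow}$: premise $S\{\mathsf 1\}$, conclusion $S[a\wp\overline a]$. - $\mathsf s$ (switch): premise $S([U\wp R]\otimes T)$, conclusion $S[U\wp(R\otimes T)]$. - $\mathsf u_1{\downarrow}$: premise $S\{R\}$, conclusion $S[R\wp\bot]$. - $\mathsf u_1{\uparrow}$: premise $S(R\otimes\mathsf 1)$, conclusion $S\{R\}$. - $\mathsf u_2{\downarrow}$: premise $S\{R\}$, conclusion $S(R\otimes\mathsf 1)$. - $\mathsf u_2{\uparrow}$: premise $S[R\wp\bot]$, conclusion $S\{R\}$. A derivation in a system (set of rules) is a finite chain of instances of its rules (possibly a single structure with no instances), leading from its top-most structure (premise) to its bottom-most structure (conclusion). A proof of $R$ is a derivation with premise $\mathsf 1$ and conclusion $R$ (the unit $\mathsf 1$ alone is a proof of $\mathsf 1$). -}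

module Defs where

open import Data.List using (List; []; _∷_)
open import Data.List.Membership.Propositional using (_∈_)
open import Data.Nat using (ℕ)

infix  30 _⟦_⟧
infix  25 ~_
infixr 20 _⊗_ _⊗ᶜ_ _ᶜ⊗_
infixr 19 _⅋_ _⅋ᶜ_ _ᶜ⅋_
infix  4  _≈_

-- The units are special atoms, so `Atom` contains them.  Consequently ai↓ also
-- has the instances [𝟙 ⅋ ~ 𝟙] and [⊥ ⅋ ~ ⊥]; modulo ≈ these are instances of u₁↓,
-- so they do not affect derivability in any system containing u₁↓.
data Atom : Set where
  var : ℕ → Atom
  one : Atom
  bot : Atom

data Structure : Set where
  atom : Atom → Structure
  _⅋_  : Structure → Structure → Structure
  _⊗_  : Structure → Structure → Structure
  ~_   : Structure → Structure

pattern 𝟙 = atom one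
pattern ⊥ = atom bot

data _≈_ : Structure → Structure → Set where
  ≈-refl  : ∀ {R} → R ≈ R
  ≈-sym   : ∀ {R T} → R ≈ T → T ≈ R
  ≈-trans : ∀ {R T U} → R ≈ T → T ≈ U → R ≈ U
  ⅋-cong  : ∀ {R R′ T T′} → R ≈ R′ → T ≈ T′ → R ⅋ T ≈ R′ ⅋ T′
  ⊗-cong  : ∀ {R R′ T T′} → R ≈ R′ → T ≈ T′ → R ⊗ T ≈ R′ ⊗ T′
  ~-cong  : ∀ {R R′} → R ≈ R′ → ~ R ≈ ~ R′
  ⅋-assoc : ∀ R T U → (R ⅋ T) ⅋ U ≈ R ⅋ (T ⅋ U)
  ⅋-comm  : ∀ R T → R ⅋ T ≈ T ⅋ R
  ⊗-assoc : ∀ R T U → (R ⊗ T) ⊗ U ≈ R ⊗ (T ⊗ U)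
  ⊗-comm  : ∀ R T → R ⊗ T ≈ T ⊗ R
  ~-⅋     : ∀ R T → ~ (R ⅋ T) ≈ (~ R) ⊗ (~ T)
  ~-⊗     : ∀ R T → ~ (R ⊗ T) ≈ (~ R) ⅋ (~ T)
  ~-invol : ∀ R → ~ (~ R) ≈ R
  ~-⊥     : ~ ⊥ ≈ 𝟙
  ~-𝟙     : ~ 𝟙 ≈ ⊥

-- There is no constructor for negation: the hole is never in its scope.
data Context : Set where
  □    : Context
  _ᶜ⅋_ : Context → Structure → Context
  _⅋ᶜ_ : Structure → Context → Context
  _ᶜ⊗_ : Context → Structure → Context
  _⊗ᶜ_ : Structure → Context → Context

_⟦_⟧ : Context → Structure → Structure
□        ⟦ R ⟧ = R
(S ᶜ⅋ T) ⟦ R ⟧ = S ⟦ R ⟧ ⅋ T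
(T ⅋ᶜ S) ⟦ R ⟧ = T ⅋ S ⟦ R ⟧
(S ᶜ⊗ T) ⟦ R ⟧ = S ⟦ R ⟧ ⊗ T
(T ⊗ᶜ S) ⟦ R ⟧ = T ⊗ S ⟦ R ⟧

data Rule : Set where
  ai↓ s u₁↓ u₁↑ u₂↓ u₂↑ : Rule

-- `Instance r P Q` has premise P and conclusion Q.
data Instance : Rule → Structure → Structure → Set where
  ai↓ : ∀ S a     → Instance ai↓ (S ⟦ 𝟙 ⟧)           (S ⟦ atom a ⅋ ~ atom a ⟧)
  s   : ∀ S R T U → Instance s   (S ⟦ (U ⅋ R) ⊗ T ⟧) (S ⟦ U ⅋ (R ⊗ T) ⟧)
  u₁↓ : ∀ S R     → Instance u₁↓ (S ⟦ R ⟧)           (S ⟦ R ⅋ ⊥ ⟧)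
  u₁↑ : ∀ S R     → Instance u₁↑ (S ⟦ R ⊗ 𝟙 ⟧)       (S ⟦ R ⟧)
  u₂↓ : ∀ S R     → Instance u₂↓ (S ⟦ R ⟧)           (S ⟦ R ⊗ 𝟙 ⟧)
  u₂↑ : ∀ S R     → Instance u₂↑ (S ⟦ R ⅋ ⊥ ⟧)       (S ⟦ R ⟧)

System : Set
System = List Rule

-- Structures are considered modulo ≈, so adjacent structures of the chain need
-- only agree up to ≈; `done` is the derivation without rule instances.
data Derivation (𝒮 : System) : Structure → Structure → Set where
  done : ∀ {P Q} → P ≈ Q → Derivation 𝒮 P Q
  step : ∀ {r P P′ Q′ Q} → r ∈ 𝒮 → P ≈ P′ → Instance r P′ Q′ →
         Derivation 𝒮 Q′ Q → Derivation 𝒮 P Q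

Proof : System → Structure → Set
Proof 𝒮 R = Derivation 𝒮 𝟙 R

MLS : System
MLS = ai↓ ∷ s ∷ u₁↓ ∷ u₁↑ ∷ u₂↓ ∷ u₂↑ ∷ []

MLSu : System
MLSu = ai↓ ∷ s ∷ u₁↓ ∷ u₂↓ ∷ []

{-# OPTIONS --safe #-}

-- MLS proofs are interpreted in Girard's phase semantics, where ≈ becomes equality of facts
-- and every rule becomes an inclusion of facts, the unit rules included.  In the phase space
-- whose elements are structures under ⅋ (with an empty structure adjoined) and whose pole is
-- provability in MLSu, every structure R is orthogonal to its own interpretation (Okada's
-- argument for cut elimination).  The empty structure lies in ⟪ 𝟙 ⟫, hence in ⟪ R ⟫ whenever
-- R is provable in MLS, and orthogonality then says that R is provable in MLSu.
module Submission where

open import Defs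
open import Algebra.Bundles using (CommutativeMonoid)
import Algebra.Properties.CommutativeSemigroup as CommutativeSemigroupProperties
open import Data.List.Membership.Propositional using (_∈_)
open import Data.List.Relation.Binary.Subset.Propositional using () renaming (_⊆_ to _⊆ᴸ_)
open import Data.List.Relation.Unary.Any using (here; there)
open import Data.Maybe using (Maybe; just; nothing)
import Data.Maybe.Relation.Binary.Pointwise as Pw
open Pw using (Pointwise; just; nothing)
open import Data.Maybe.Relation.Unary.Any using (Any; just; drop-just)
open import Data.Nat using (ℕ)
open import Data.Product using (_×_; _,_; proj₁; proj₂)
open import Function using (id)
open import Function.Bundles using (_⇔_; mk⇔)
open import Level using (0ℓ)
open import Relation.Binary.Definitions using (_Respects_)
open import Relation.Binary.PropositionalEquality using (refl)
open import Relation.Unary using (Pred; _⊆_; _≐_)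
open import Relation.Unary.Properties using (≐-refl; ≐-sym; ≐-trans)

-- Phase semantics: closed sets, and soundness of all six rules.

module PhaseSemantics
  (M : CommutativeMonoid 0ℓ 0ℓ)
  (Pole : Pred (CommutativeMonoid.Carrier M) 0ℓ)
  (Pole-resp : Pole Respects (CommutativeMonoid._≈_ M))
  (V : ℕ → Pred (CommutativeMonoid.Carrier M) 0ℓ) where

  module M = CommutativeMonoid M
  open M using (_∙_; ε; assoc; comm; identityˡ; identityʳ; ∙-congˡ) renaming (Carrier to C)
  open CommutativeSemigroupProperties M.commutativeSemigroup

  infix  8 _^⊥
  infixr 7 _⊙⊥_

  _^⊥ : Pred C 0ℓ → Pred C 0ℓ
  (X ^⊥) x = ∀ y → X y → Pole (x ∙ y)

  -- The orthogonal of the pointwise product of X and Y.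
  _⊙⊥_ : Pred C 0ℓ → Pred C 0ℓ → Pred C 0ℓ
  (X ⊙⊥ Y) z = ∀ x y → X x → Y y → Pole (z ∙ (x ∙ y))

  Closed : Pred C 0ℓ → Set
  Closed X = X ^⊥ ^⊥ ⊆ X

  -- Every clause yields a closed set whatever `V` is: a variable goes to an orthogonal, and `⊗` to
  -- the double orthogonal of the pointwise product.
  ⟪_⟫ : Structure → Pred C 0ℓ
  ⟪ atom (var n) ⟫ = V n ^⊥
  ⟪ 𝟙 ⟫            = Pole ^⊥
  ⟪ ⊥ ⟫            = Pole
  ⟪ R ⅋ T ⟫        = ⟪ R ⟫ ^⊥ ⊙⊥ ⟪ T ⟫ ^⊥
  ⟪ R ⊗ T ⟫        = (⟪ R ⟫ ⊙⊥ ⟪ T ⟫) ^⊥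
  ⟪ ~ R ⟫          = ⟪ R ⟫ ^⊥

  ^⊥-anti : ∀ {X Y} → X ⊆ Y → Y ^⊥ ⊆ X ^⊥
  ^⊥-anti X⊆Y p y y∈X = p y (X⊆Y y∈X)

  ⊙⊥-anti : ∀ {X X′ Y Y′} → X ⊆ X′ → Y ⊆ Y′ → X′ ⊙⊥ Y′ ⊆ X ⊙⊥ Y
  ⊙⊥-anti X⊆X′ Y⊆Y′ p x y x∈X y∈Y = p x y (X⊆X′ x∈X) (Y⊆Y′ y∈Y)

  ^⊥-cong : ∀ {X Y} → X ≐ Y → X ^⊥ ≐ Y ^⊥
  ^⊥-cong (X⊆Y , Y⊆X) = ^⊥-anti Y⊆X , ^⊥-anti X⊆Y

  ⊙⊥-cong : ∀ {X X′ Y Y′} → X ≐ X′ → Y ≐ Y′ → X ⊙⊥ Y ≐ X′ ⊙⊥ Y′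
  ⊙⊥-cong (X⊆ , X⊇) (Y⊆ , Y⊇) = ⊙⊥-anti X⊇ Y⊇ , ⊙⊥-anti X⊆ Y⊆

  ⊆^⊥^⊥ : ∀ {X} → X ⊆ X ^⊥ ^⊥
  ⊆^⊥^⊥ x∈X y y∈X^⊥ = Pole-resp (comm y _) (y∈X^⊥ _ x∈X)

  ^⊥-closed : ∀ {X} → Closed (X ^⊥)
  ^⊥-closed = ^⊥-anti ⊆^⊥^⊥

  ⊙⊥-closed : ∀ {X Y} → Closed (X ⊙⊥ Y)
  ⊙⊥-closed p x y x∈X y∈Y =
    p (x ∙ y) λ z z∈ → Pole-resp (comm z (x ∙ y)) (z∈ x y x∈X y∈Y)

  -- `Pole` is the orthogonal of the singleton of `ε`, and `ε` lies in `Pole ^⊥`.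
  Pole-closed : Closed Pole
  Pole-closed p =
    Pole-resp (identityʳ _) (p ε λ _ → Pole-resp (M.sym (identityˡ _)))

  ⟪⟫-closed : ∀ R → Closed ⟪ R ⟫
  ⟪⟫-closed (atom (var n)) = ^⊥-closed
  ⟪⟫-closed 𝟙       = ^⊥-closed
  ⟪⟫-closed ⊥       = Pole-closed
  ⟪⟫-closed (R ⅋ T) = ⊙⊥-closed
  ⟪⟫-closed (R ⊗ T) = ^⊥-closed
  ⟪⟫-closed (~ R)   = ^⊥-closed

  ⟪⟫-^⊥^⊥ : ∀ R → ⟪ R ⟫ ^⊥ ^⊥ ≐ ⟪ R ⟫
  ⟪⟫-^⊥^⊥ R = ⟪⟫-closed R , ⊆^⊥^⊥

  ⊙⊥-comm : ∀ {X Y} → X ⊙⊥ Y ⊆ Y ⊙⊥ X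
  ⊙⊥-comm p y x y∈Y x∈X = Pole-resp (x∙yz≈x∙zy _ x y) (p x y x∈X y∈Y)

  -- Both bracketings of a triple product are orthogonal to the same elements, because a
  -- double orthogonal may be dropped inside a product.
  ⊙⊥-assoc⊆ : ∀ {X Y Z} → (X ⊙⊥ Y) ^⊥ ⊙⊥ Z ⊆ X ⊙⊥ (Y ⊙⊥ Z) ^⊥
  ⊙⊥-assoc⊆ {X} {Y} {Z} {w} p x t x∈X t∈ =
    Pole-resp t∙wx≈w∙xt (t∈ (w ∙ x) λ y z y∈Y z∈Z →
      Pole-resp (regroup y z)
        (p (x ∙ y) z (λ u u∈ → Pole-resp (comm u (x ∙ y)) (u∈ x y x∈X y∈Y)) z∈Z))
    where
    t∙wx≈w∙xt : t ∙ (w ∙ x) M.≈ w ∙ (x ∙ t)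
    t∙wx≈w∙xt = x∙yz≈y∙zx t w x

    regroup : ∀ y z → w ∙ ((x ∙ y) ∙ z) M.≈ (w ∙ x) ∙ (y ∙ z)
    regroup y z = M.trans (∙-congˡ (assoc x y z)) (M.sym (assoc w x (y ∙ z)))

  ⊙⊥-assoc : ∀ {X Y Z} → (X ⊙⊥ Y) ^⊥ ⊙⊥ Z ≐ X ⊙⊥ (Y ⊙⊥ Z) ^⊥
  -- The converse is the same inclusion with `X` and `Z` exchanged, conjugated by commutativity.
  ⊙⊥-assoc {X} {Y} {Z} = ⊙⊥-assoc⊆ {X} {Y} {Z} , λ p →
    ⊙⊥-comm {Z} {(X ⊙⊥ Y) ^⊥}
      (⊙⊥-anti id (^⊥-anti ⊙⊥-comm)
        (⊙⊥-assoc⊆ {Z} {Y} {X}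
          (⊙⊥-anti (^⊥-anti ⊙⊥-comm) id (⊙⊥-comm {X} {(Y ⊙⊥ Z) ^⊥} p))))

  ⟪⟫-resp-≈ : ∀ {R T} → R ≈ T → ⟪ R ⟫ ≐ ⟪ T ⟫
  ⟪⟫-resp-≈ ≈-refl          = ≐-refl
  ⟪⟫-resp-≈ (≈-sym e)       = ≐-sym (⟪⟫-resp-≈ e)
  ⟪⟫-resp-≈ (≈-trans e f)   = ≐-trans (⟪⟫-resp-≈ e) (⟪⟫-resp-≈ f)
  ⟪⟫-resp-≈ (⅋-cong e f)    = ⊙⊥-cong (^⊥-cong (⟪⟫-resp-≈ e)) (^⊥-cong (⟪⟫-resp-≈ f))
  ⟪⟫-resp-≈ (⊗-cong e f)    = ^⊥-cong (⊙⊥-cong (⟪⟫-resp-≈ e) (⟪⟫-resp-≈ f))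
  ⟪⟫-resp-≈ (~-cong e)      = ^⊥-cong (⟪⟫-resp-≈ e)
  ⟪⟫-resp-≈ (⅋-assoc R T U) = ⊙⊥-assoc
  ⟪⟫-resp-≈ (⅋-comm R T)    = ⊙⊥-comm , ⊙⊥-comm
  ⟪⟫-resp-≈ (⊗-assoc R T U) = ^⊥-cong ⊙⊥-assoc
  ⟪⟫-resp-≈ (⊗-comm R T)    = ^⊥-anti ⊙⊥-comm , ^⊥-anti ⊙⊥-comm
  ⟪⟫-resp-≈ (~-⅋ R T)       = ≐-refl
  -- Unlike `~-⅋`, which holds by definition, this law has to cancel double orthogonals, so
  -- closedness enters.
  ⟪⟫-resp-≈ (~-⊗ R T)       =
    ≐-trans (⊙⊥-closed , ⊆^⊥^⊥) (⊙⊥-cong (≐-sym (⟪⟫-^⊥^⊥ R)) (≐-sym (⟪⟫-^⊥^⊥ T)))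
  ⟪⟫-resp-≈ (~-invol R)     = ⟪⟫-^⊥^⊥ R
  ⟪⟫-resp-≈ ~-⊥             = ≐-refl
  ⟪⟫-resp-≈ ~-𝟙             = ⟪⟫-^⊥^⊥ ⊥

  -- The hole is never under `~`, and each connective applies two antitone operations to every
  -- argument.
  ⟪⟫-mono : ∀ S {R T} → ⟪ R ⟫ ⊆ ⟪ T ⟫ → ⟪ S ⟦ R ⟧ ⟫ ⊆ ⟪ S ⟦ T ⟧ ⟫
  ⟪⟫-mono □        R⊆T = R⊆T
  ⟪⟫-mono (S ᶜ⅋ U) R⊆T = ⊙⊥-anti (^⊥-anti (⟪⟫-mono S R⊆T)) id
  ⟪⟫-mono (U ⅋ᶜ S) R⊆T = ⊙⊥-anti id (^⊥-anti (⟪⟫-mono S R⊆T))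
  ⟪⟫-mono (S ᶜ⊗ U) R⊆T = ^⊥-anti (⊙⊥-anti (⟪⟫-mono S R⊆T) id)
  ⟪⟫-mono (U ⊗ᶜ S) R⊆T = ^⊥-anti (⊙⊥-anti id (⟪⟫-mono S R⊆T))

  Pole^⊥⊆⅋~ : ∀ R → ⟪ 𝟙 ⟫ ⊆ ⟪ R ⅋ ~ R ⟫
  Pole^⊥⊆⅋~ R p x y x∈ y∈ = p (x ∙ y) (Pole-resp (comm y x) (y∈ x x∈))

  -- Par acts as linear implication: `q` in `⟪ U ⅋ R ⟫` composed with `u` in `⟪ U ⟫ ^⊥` lands in
  -- `⟪ R ⟫`, because `⟪ R ⟫` is closed.
  switch-sound : ∀ U R T → ⟪ (U ⅋ R) ⊗ T ⟫ ⊆ ⟪ U ⅋ (R ⊗ T) ⟫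
  switch-sound U R T p u v u∈ v∈ = p (u ∙ v) λ q t q∈ t∈ →
    Pole-resp (regroup q t) (⊙⊥-closed v∈ (q ∙ u) t
      (⟪⟫-closed R λ r r∈ → Pole-resp (M.sym (assoc q u r)) (q∈ u r u∈ r∈)) t∈)
    where
    regroup : ∀ q t → v ∙ ((q ∙ u) ∙ t) M.≈ (u ∙ v) ∙ (q ∙ t)
    regroup q t = M.trans (∙-congˡ (xy∙z≈y∙xz q u t)) (x∙yz≈yx∙z v u (q ∙ t))

  -- One inclusion serves `u₁↓`, the other `u₂↑`; the latter tests against `ε`, which is orthogonal
  -- to the pole.
  ⅋⊥-sound : ∀ R → ⟪ R ⅋ ⊥ ⟫ ≐ ⟪ R ⟫
  ⅋⊥-sound R = to , from
    where
    to : ⟪ R ⅋ ⊥ ⟫ ⊆ ⟪ R ⟫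
    to p = ⟪⟫-closed R λ x x∈ →
      Pole-resp (∙-congˡ (identityʳ x))
        (p x ε x∈ λ y → Pole-resp (M.sym (identityˡ y)))

    from : ⟪ R ⟫ ⊆ ⟪ R ⅋ ⊥ ⟫
    from {w} w∈ x y x∈ y∈ =
      Pole-resp (x∙yz≈y∙zx y w x) (y∈ (w ∙ x) (Pole-resp (comm x w) (x∈ w w∈)))

  ⊗𝟙-sound : ∀ R → ⟪ R ⊗ 𝟙 ⟫ ≐ ⟪ R ⟫
  ⊗𝟙-sound R = to , from
    where
    to : ⟪ R ⊗ 𝟙 ⟫ ⊆ ⟪ R ⟫
    to p = ⟪⟫-closed R λ x x∈ → p x λ r y r∈ y∈ →
      Pole-resp (x∙yz≈y∙zx y x r) (y∈ (x ∙ r) (x∈ r r∈))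

    from : ⟪ R ⟫ ⊆ ⟪ R ⊗ 𝟙 ⟫
    from {w} w∈ z z∈ = Pole-resp (M.trans (∙-congˡ (identityʳ w)) (comm z w))
      (z∈ w ε w∈ λ y → Pole-resp (M.sym (identityˡ y)))

  sound-instance : ∀ {r P Q} → Instance r P Q → ⟪ P ⟫ ⊆ ⟪ Q ⟫
  sound-instance (ai↓ S a)   = ⟪⟫-mono S (Pole^⊥⊆⅋~ (atom a))
  sound-instance (s S R T U) = ⟪⟫-mono S (switch-sound U R T)
  sound-instance (u₁↓ S R)   = ⟪⟫-mono S (proj₂ (⅋⊥-sound R))
  sound-instance (u₁↑ S R)   = ⟪⟫-mono S (proj₁ (⊗𝟙-sound R))
  sound-instance (u₂↓ S R)   = ⟪⟫-mono S (proj₂ (⊗𝟙-sound R))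
  sound-instance (u₂↑ S R)   = ⟪⟫-mono S (proj₁ (⅋⊥-sound R))

  sound : ∀ {𝒮 P Q} → Derivation 𝒮 P Q → ⟪ P ⟫ ⊆ ⟪ Q ⟫
  sound (done e)       p = proj₁ (⟪⟫-resp-≈ e) p
  sound (step _ e i d) p = sound d (sound-instance i (proj₁ (⟪⟫-resp-≈ e) p))

  ε∈⟪proved⟫ : ∀ {𝒮 R} → Proof 𝒮 R → ⟪ R ⟫ ε
  ε∈⟪proved⟫ d = sound d λ y → Pole-resp (M.sym (identityˡ y))

-- Composing derivations and tensoring proofs.

weaken : ∀ {𝒮 𝒮′ P Q} → 𝒮 ⊆ᴸ 𝒮′ → Derivation 𝒮 P Q → Derivation 𝒮′ P Q
weaken 𝒮⊆𝒮′ (done e)       = done e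
weaken 𝒮⊆𝒮′ (step r e i d) = step (𝒮⊆𝒮′ r) e i (weaken 𝒮⊆𝒮′ d)

MLSu⊆MLS : MLSu ⊆ᴸ MLS
MLSu⊆MLS (here refl)                         = here refl
MLSu⊆MLS (there (here refl))                 = there (here refl)
MLSu⊆MLS (there (there (here refl)))         = there (there (here refl))
MLSu⊆MLS (there (there (there (here refl)))) = there (there (there (there (here refl))))

≈-then : ∀ {𝒮 P Q U} → P ≈ Q → Derivation 𝒮 Q U → Derivation 𝒮 P U
≈-then e (done f)       = done (≈-trans e f)
≈-then e (step r f i d) = step r (≈-trans e f) i d

infixr 5 _then_

_then_ : ∀ {𝒮 P Q U} → Derivation 𝒮 P Q → Derivation 𝒮 Q U → Derivation 𝒮 P U
done e       then d′ = ≈-then e d′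
step r e i d then d′ = step r e i (d then d′)

by : ∀ {𝒮 r P Q} → r ∈ 𝒮 → Instance r P Q → Derivation 𝒮 P Q
by r i = step r ≈-refl i (done ≈-refl)

instance-⊗ʳ : ∀ {r P Q} T → Instance r P Q → Instance r (P ⊗ T) (Q ⊗ T)
instance-⊗ʳ T (ai↓ S a)    = ai↓ (S ᶜ⊗ T) a
instance-⊗ʳ T (s S R T′ U) = s (S ᶜ⊗ T) R T′ U
instance-⊗ʳ T (u₁↓ S R)    = u₁↓ (S ᶜ⊗ T) R
instance-⊗ʳ T (u₁↑ S R)    = u₁↑ (S ᶜ⊗ T) R
instance-⊗ʳ T (u₂↓ S R)    = u₂↓ (S ᶜ⊗ T) R
instance-⊗ʳ T (u₂↑ S R)    = u₂↑ (S ᶜ⊗ T) R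

derivation-⊗ʳ : ∀ {𝒮 P Q} T → Derivation 𝒮 P Q → Derivation 𝒮 (P ⊗ T) (Q ⊗ T)
derivation-⊗ʳ T (done e)       = done (⊗-cong e ≈-refl)
derivation-⊗ʳ T (step r e i d) =
  step r (⊗-cong e ≈-refl) (instance-⊗ʳ T i) (derivation-⊗ʳ T d)

pattern ai↓∈ = here refl
pattern s∈   = there (here refl)
pattern u₁↓∈ = there (there (here refl))
pattern u₂↓∈ = there (there (there (here refl)))

prove-⊗ : ∀ {P Q} → Proof MLSu P → Proof MLSu Q → Proof MLSu (P ⊗ Q)
prove-⊗ {P} {Q} p q =
  -- `u₂↓` creates a second `𝟙`, so each factor grows from its own unit; commutativity brings the
  -- next one to the left.
  by u₂↓∈ (u₂↓ □ 𝟙) then derivation-⊗ʳ 𝟙 p then done (⊗-comm P 𝟙) then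
  derivation-⊗ʳ P q then done (⊗-comm Q P)

-- The phase space of structures with provability in `MLSu` as pole.

-- Adjoining a neutral element; [R ⅋ ⊥] ≈ R fails, so ⊥ itself is not neutral for ⅋.
infixr 6 _⊕_

_⊕_ : Maybe Structure → Maybe Structure → Maybe Structure
nothing ⊕ y       = y
just R  ⊕ nothing = just R
just R  ⊕ just T  = just (R ⅋ T)

⊕-commutativeMonoid : CommutativeMonoid 0ℓ 0ℓ
⊕-commutativeMonoid = record
  { Carrier = Maybe Structure ; _≈_ = Pointwise _≈_ ; _∙_ = _⊕_ ; ε = nothing
  ; isCommutativeMonoid = record
    { isMonoid = record
      { isSemigroup = record
        { isMagma = record
          { isEquivalence = record
            { refl  = ≋-refl
            ; sym   = Pw.sym ≈-sym
            ; trans = Pw.trans ≈-trans }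
          ; ∙-cong = ⊕-cong }
        ; assoc = ⊕-assoc }
      ; identity = (λ _ → ≋-refl) , ⊕-identityʳ }
    ; comm = ⊕-comm } }
  where
  _≋_ : Maybe Structure → Maybe Structure → Set
  _≋_ = Pointwise _≈_

  ≋-refl : ∀ {x} → x ≋ x
  ≋-refl = Pw.refl ≈-refl

  ⊕-cong : ∀ {x x′ y y′} → x ≋ x′ → y ≋ y′ → (x ⊕ y) ≋ (x′ ⊕ y′)
  ⊕-cong nothing  f        = f
  ⊕-cong (just e) nothing  = just e
  ⊕-cong (just e) (just f) = just (⅋-cong e f)

  ⊕-assoc : ∀ x y z → ((x ⊕ y) ⊕ z) ≋ (x ⊕ (y ⊕ z))
  ⊕-assoc nothing  y        z        = ≋-refl
  ⊕-assoc (just _) nothing  z        = ≋-refl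
  ⊕-assoc (just _) (just _) nothing  = ≋-refl
  ⊕-assoc (just R) (just T) (just U) = just (⅋-assoc R T U)

  ⊕-identityʳ : ∀ x → (x ⊕ nothing) ≋ x
  ⊕-identityʳ nothing  = ≋-refl
  ⊕-identityʳ (just _) = ≋-refl

  ⊕-comm : ∀ x y → (x ⊕ y) ≋ (y ⊕ x)
  ⊕-comm nothing  nothing  = ≋-refl
  ⊕-comm nothing  (just _) = ≋-refl
  ⊕-comm (just _) nothing  = ≋-refl
  ⊕-comm (just R) (just T) = just (⅋-comm R T)

-- The empty structure stays outside the pole, since `Any` holds only of `just`.
Provable : Pred (Maybe Structure) 0ℓ
Provable = Any (Proof MLSu)

Provable-resp : Provable Respects Pointwise _≈_
Provable-resp (just e) (just p) = just (p then done e)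

-- This is the tensor rule of the sequent calculus: one switch pulls each nonempty context out of
-- the copar.
prove-⊗-in-context : ∀ x y {R T} → Provable (x ⊕ just R) → Provable (y ⊕ just T) →
                     Provable ((x ⊕ y) ⊕ just (R ⊗ T))
prove-⊗-in-context nothing nothing (just p) (just q) = just (prove-⊗ p q)
prove-⊗-in-context (just U) nothing {R} {T} (just p) (just q) =
  just (prove-⊗ p q then by s∈ (s □ R T U))
prove-⊗-in-context nothing (just W) {R} {T} (just p) (just q) =
  just (prove-⊗ q p then by s∈ (s □ T R W) then done (⅋-cong ≈-refl (⊗-comm T R)))
prove-⊗-in-context (just U) (just W) {R} {T} (just p) (just q) =
  just (prove-⊗ p q then
        by s∈ (s □ R (W ⅋ T) U) then
        done (⅋-cong ≈-refl (⊗-comm R (W ⅋ T))) then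
        by s∈ (s (U ⅋ᶜ □) T R W) then
        done (≈-trans (⅋-cong ≈-refl (⅋-cong ≈-refl (⊗-comm T R)))
                      (≈-sym (⅋-assoc U W (R ⊗ T)))))

prove-⅋⊥ : ∀ {x} → Provable x → Provable (x ⊕ just ⊥)
prove-⅋⊥ {just R} (just p) = just (p then by u₁↓∈ (u₁↓ □ R))

-- `V n` is a singleton up to `≈`, so a variable denotes the set of contexts whose par with it is
-- provable.
open PhaseSemantics ⊕-commutativeMonoid Provable Provable-resp
  (λ n → Pointwise _≈_ (just (atom (var n))))

open CommutativeMonoid ⊕-commutativeMonoid using (∙-congˡ; comm)
  renaming (refl to ≋-refl; trans to ≋-trans)

-- The second component carries the induction through ~, whose interpretation is contravariant.
orthogonal : ∀ R → (⟪ R ⟫ ^⊥) (just R) × ⟪ R ⟫ (just (~ R))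
orthogonal (atom (var n)) =
    (λ x x∈ → Provable-resp (comm x _) (x∈ _ ≋-refl))
  , λ y y≈ → Provable-resp
      (≋-trans (just (⅋-comm (atom (var n)) (~ atom (var n)))) (∙-congˡ y≈))
      (just (by ai↓∈ (ai↓ □ (var n))))
orthogonal 𝟙 =
    -- The test element is `just 𝟙`, proved by the empty derivation.
    (λ x x∈ → Provable-resp (comm x _) (x∈ _ (just (done ≈-refl))))
  , λ y y∈ → Provable-resp (≋-trans (∙-congˡ (just (≈-sym ~-𝟙))) (comm y _)) (prove-⅋⊥ y∈)
orthogonal ⊥ =
    (λ y y∈ → Provable-resp (comm y _) (prove-⅋⊥ y∈))
  , just (done (≈-sym ~-⊥))
orthogonal (R ⅋ T) =
    (λ z z∈ → Provable-resp (comm z _)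
      (z∈ _ _ (proj₁ (orthogonal R)) (proj₁ (orthogonal T))))
  , λ x y x∈ y∈ → Provable-resp
      (≋-trans (∙-congˡ (just (≈-sym (~-⅋ R T)))) (comm (x ⊕ y) _))
      (prove-⊗-in-context x y (x∈ _ (proj₂ (orthogonal R))) (y∈ _ (proj₂ (orthogonal T))))
orthogonal (R ⊗ T) =
    -- The tensor rule places `just (R ⊗ T)` in `⟪ R ⟫ ⊙⊥ ⟪ T ⟫`.
    (λ z z∈ → Provable-resp (comm z _) (z∈ (just (R ⊗ T)) λ x y x∈ y∈ →
      Provable-resp (comm (x ⊕ y) _)
        (prove-⊗-in-context x y
          (Provable-resp (comm _ x) (proj₁ (orthogonal R) x x∈))
          (Provable-resp (comm _ y) (proj₁ (orthogonal T) y y∈)))))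
  , λ z z∈ → Provable-resp
      (≋-trans (∙-congˡ (just (≈-sym (~-⊗ R T)))) (comm z _))
      (z∈ _ _ (proj₂ (orthogonal R)) (proj₂ (orthogonal T)))
orthogonal (~ R) =
    ⊆^⊥^⊥ (proj₂ (orthogonal R))
  , λ x x∈ → Provable-resp
      (≋-trans (comm _ x) (≋-trans (∙-congˡ {x} (just (≈-sym (~-invol R)))) (comm x _)))
      (proj₁ (orthogonal R) x x∈)

theorem1p19 : (R : Structure) → Proof MLS R ⇔ Proof MLSu R
theorem1p19 R =
  -- Testing against `nothing` suffices, as `just R ⊕ nothing` reduces to `just R`.
  mk⇔ (λ d → drop-just (proj₁ (orthogonal R) nothing (ε∈⟪proved⟫ d))) (weaken MLSu⊆MLS)
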